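{- Let $f$ be a regular endomorphism of the countable universal bipartite graph $B$. (i) If the image of $f$ is infinite, then the $\mathscr{D}$-class of $f$ contains $2^{\aleph_0}$ many $\mathscr{L}$-classes and $2^{\aleph_0}$ many $\mathscr{R}$-classes. (ii) If the image of $f$ is finite but not isomorphic to $K_{1,1}$, then the $\mathscr{D}$-class of $f$ contains $\aleph_0$ many $\mathscr{L}$-classes and $2^{\aleph_0}$ many $\mathscr{R}$-classes. (iii) If $\operatorname{im} f\cong K_{1,1}$, then the $\mathscr{D}$-class of $f$ contains $\aleph_0$ many $\mathscr{L}$-classes and one $\mathscr{R}$-class.
   Context: A bipartite graph is a relational structure $(V,E,P)$ where $E$ is an irreflexive symmetric binary relation on $V$, $P=(V_0\times V_0)\cup(V_1\times V_1)$ for some partition $V=V_0\,\dot\cup\,V_1$, and $(u,v)\in E$ implies $(u,v)\notin P$; homomorphisms preserve $E$ and $P$. The countable universal bipartite graph $B$ is the Fraïssé limit of the finite bipartite graphs in this sense; $\operatorname{End} B$ is its endomorphism monoid. For $f\in\operatorname{End} B$ with $B=(V,E,P)$, $\operatorname{im} f=(Vf,Ef,P\cap(Vf\times Vf))$. $K_{1,1}$ is the bipartite graph with one vertex in each part joined by an edge. Green's relations on a monoid $M$: $f\,\mathscr{L}\,g$ iff $Mf=Mg$; $f\,\mathscr{R}\,g$ iff $fM=gM$; $\mathscr{D}=\mathscr{L}\circ\mathscr{R}$. An element $f$ is regular if $fgf=f$ for some $g\in M$. -}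

module Defs where

open import Data.Nat using (ℕ)
open import Data.Bool using (Bool; true; false)
open import Data.Unit using (⊤)
open import Data.Empty using (⊥)
open import Data.Product using (Σ; ∃; ∃-syntax; _×_; _,_)
open import Data.Sum using (_⊎_)
open import Data.List using (List)
open import Data.List.Membership.Propositional using (_∈_; _∉_)
open import Relation.Nullary using (¬_)
open import Relation.Binary.PropositionalEquality using (_≡_; _≢_)
open import Function.Bundles using (_⇔_)

record Str (V : Set) : Set₁ where
  field
    E : V → V → Set
    P : V → V → Set
open Str public

IsBipartiteWith : {V : Set} → Str V → (V → Bool) → Set
IsBipartiteWith G part =
    (∀ x → ¬ E G x x)
  × (∀ x y → E G x y → E G y x)
  × (∀ x y → P G x y ⇔ (part x ≡ part y))
  × (∀ x y → E G x y → ¬ P G x y)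

-- Extension property of the Fraïssé limit of finite bipartite graphs:
-- every one-point extension (in the class) of a finite substructure
-- (listed by xs) is realised in G.  The new vertex lies in part c and is
-- E-adjacent exactly to the x ∈ xs with e x ≡ true (which must lie in
-- the other part).
ExtensionProperty : Str ℕ → (ℕ → Bool) → Set
ExtensionProperty G part =
  (xs : List ℕ) (c : Bool) (e : ℕ → Bool) →
  (∀ x → x ∈ xs → e x ≡ true → part x ≢ c) →
  ∃[ v ] (v ∉ xs) × (part v ≡ c) × (∀ x → x ∈ xs → (E G v x ⇔ (e x ≡ true)))

-- G (on the countable vertex set ℕ) is the countable universal
-- bipartite graph B: a countable bipartite graph with the extension
-- property (this characterises the Fraïssé limit up to isomorphism).
IsUniversalBipartite : Str ℕ → Set
IsUniversalBipartite G =
  Σ (ℕ → Bool) λ part → IsBipartiteWith G part × ExtensionProperty G part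

-- Endomorphisms and the monoid End B.
-- Maps are written on the right as in the paper: (f ⨾ g) x = g (f x),
-- i.e. "fg" means first f then g.

record End (G : Str ℕ) : Set where
  constructor mkEnd
  field
    fun   : ℕ → ℕ
    presE : ∀ x y → E G x y → E G (fun x) (fun y)
    presP : ∀ x y → P G x y → P G (fun x) (fun y)
open End public

module _ {G : Str ℕ} where

  infixl 7 _⨾_
  _⨾_ : End G → End G → End G
  f ⨾ g = mkEnd (λ x → fun g (fun f x))
                (λ x y e → presE g _ _ (presE f x y e))
                (λ x y p → presP g _ _ (presP f x y p))

  _≈_ : End G → End G → Set
  f ≈ g = ∀ x → fun f x ≡ fun g x

  _ℒ_ : End G → End G → Set
  f ℒ g = (∃[ a ] f ≈ (a ⨾ g)) × (∃[ b ] g ≈ (b ⨾ f))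

  _ℛ_ : End G → End G → Set
  f ℛ g = (∃[ a ] f ≈ (g ⨾ a)) × (∃[ b ] g ≈ (f ⨾ b))

  _𝒟_ : End G → End G → Set
  f 𝒟 g = ∃[ h ] (f ℒ h) × (h ℛ g)

  Regular : End G → Set
  Regular f = ∃[ g ] (f ⨾ g ⨾ f) ≈ f

  InImage : End G → ℕ → Set
  InImage f y = ∃[ x ] fun f x ≡ y

  FiniteImage : End G → Set
  FiniteImage f = ∃[ ys ] (∀ y → InImage f y → y ∈ ys)

  InfiniteImage : End G → Set
  InfiniteImage f = ¬ FiniteImage f

  DClass : End G → Set
  DClass f = Σ (End G) λ g → f 𝒟 g

  -- "The 𝒟-class of f contains exactly |S| many ∼-classes", where S is
  -- given with an equivalence ≈S: there is a map φ from the 𝒟-class to S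
  -- inducing a bijection (𝒟-class / ∼) ≅ (S / ≈S):
  -- φ g ≈S φ h iff g ∼ h, and φ is surjective up to ≈S.
  NumClassesInD : (End G → End G → Set) → End G →
                  (S : Set) → (S → S → Set) → Set
  NumClassesInD _∼_ f S _≈S_ =
    Σ (DClass f → S) λ φ →
        (∀ (g h : DClass f) → (Data.Product.proj₁ g ∼ Data.Product.proj₁ h) ⇔ (φ g ≈S φ h))
      × (∀ s → ∃[ g ] φ g ≈S s)

K11 : Str Bool
K11 = record { E = λ x y → x ≢ y ; P = λ x y → x ≡ y }

ImageIsoK11 : {G : Str ℕ} → End G → Set
ImageIsoK11 {G} f =
  Σ (Bool → ℕ) λ φ →
      (∀ b → InImage f (φ b))
    × (∀ y → InImage f y → ∃[ b ] φ b ≡ y)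
    × (∀ b c → φ b ≡ φ c → b ≡ c)
    × (∀ b c → E G (φ b) (φ c) ⇔ E K11 b c)
    × (∀ b c → P G (φ b) (φ c) ⇔ P K11 b c)

Cantor : Set
Cantor = ℕ → Bool

_≈C_ : Cantor → Cantor → Set
α ≈C β = ∀ n → α n ≡ β n

-- classical logic (the paper works in ZFC)
LEM : Set₁
LEM = (A : Set) → A ⊎ ¬ A

{-# OPTIONS --safe #-}
module Submission where

-- For regular endomorphisms ℒ is equality of images and ℛ is equality of
-- kernels, so classes embed into Cantor space (into ℕ when images are finite).
-- For the converse embeddings, a bipartite graph H on ℕ can be copied into B so
-- sparsely that every vertex outside the copy has finitely many neighbours in
-- it; then any homomorphism from H to B extends to an endomorphism of B.
-- Taking for H a blow-up of B, whose projection to B extends to b ∈ End B, each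
-- section a of b gives f a 𝒟 f, and sections that differ on im f give different
-- images.
-- Taking for H the disjoint union of B and an independent set Z, and extending
-- the identity on B by arbitrary maps of Z to two vertices of one part which f
-- separates, gives maps b with b f 𝒟 f and continuum many kernels; two such
-- vertices exist unless im f ≅ K₁,₁.  Cantor–Schröder–Bernstein concludes.

open import Defs
open import Data.Bool using (Bool; true; false; if_then_else_)
open import Data.Bool.Properties using () renaming (_≟_ to _≟ᵇ_)
open import Data.Empty using (⊥)
open import Data.List using (List; []; _∷_; _++_; map; upTo)
open import Data.List.Membership.Propositional using (_∈_; _∉_)
open import Data.List.Membership.Propositional.Properties using (∈-map⁺; ∈-++⁺ˡ; ∈-++⁺ʳ; ∈-upTo⁺)
open import Data.List.Relation.Unary.Any using (here; there)
open import Data.Nat using (ℕ; zero; suc; s≤s; _<_; _≟_)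
open import Data.Nat.Induction using (<-rec)
open import Data.Nat.Properties using (<-cmp; m<1+n⇒m<n∨m≡n; n<1+n; m<n⇒m<1+n; suc-injective; ≮⇒≥; ≤-antisym; _<?_)
open import Data.Product using (Σ; ∃; ∃-syntax; _×_; _,_; proj₁; proj₂)
open import Data.Product.Properties using (,-injectiveˡ; ,-injectiveʳ)
open import Data.Sum using (_⊎_; inj₁; inj₂; [_,_]′)
open import Data.Unit using (⊤; tt)
open import Function using (_∘_; id; const; case_of_)
open import Function.Bundles using (_⇔_; mk⇔; Equivalence)
open import Function.Construct.Composition using (_⇔-∘_)
open import Function.Construct.Symmetry using (⇔-sym)
open import Relation.Binary.Definitions using (tri<; tri≈; tri>)
open import Relation.Binary.Structures using (IsEquivalence)
open import Relation.Binary.PropositionalEquality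
open import Relation.Nullary using (¬_; yes; no; contradiction)

open Equivalence using (to; from)

-- Injective codings of pairs and lists by natural numbers

double : ℕ → ℕ
double zero    = 0
double (suc n) = suc (suc (double n))

enc : ℕ × Bool → ℕ
enc (n , false) = double n
enc (n , true)  = suc (double n)

dec : ℕ → ℕ × Bool
dec zero = 0 , false
dec (suc k) with dec k
... | n , false = n , true
... | n , true  = suc n , false

dec-double : ∀ n → dec (double n) ≡ (n , false)
dec-double zero = refl
dec-double (suc n) rewrite dec-double n = refl

dec-enc : ∀ i → dec (enc i) ≡ i
dec-enc (n , false) = dec-double n
dec-enc (n , true)  rewrite dec-double n = refl

enc-injective : ∀ {i j} → enc i ≡ enc j → i ≡ j
enc-injective {i} {j} eq = trans (sym (dec-enc i)) (trans (cong dec eq) (dec-enc j))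

-- pair m n = 2ᵐ (2n + 1)
pair : ℕ → ℕ → ℕ
pair zero    n = enc (n , true)
pair (suc m) n = enc (pair m n , false)

pair-injective : ∀ m n m′ n′ → pair m n ≡ pair m′ n′ → m ≡ m′ × n ≡ n′
pair-injective zero n zero n′ eq = refl , ,-injectiveˡ (enc-injective {n , true} {n′ , true} eq)
pair-injective zero n (suc m′) n′ eq
  with () ← enc-injective {n , true} {pair m′ n′ , false} eq
pair-injective (suc m) n zero n′ eq
  with () ← enc-injective {pair m n , false} {n′ , true} eq
pair-injective (suc m) n (suc m′) n′ eq =
  let p , q = pair-injective m n m′ n′
                (,-injectiveˡ (enc-injective {pair m n , false} {pair m′ n′ , false} eq))
  in cong suc p , q

listCode : List ℕ → ℕ
listCode []       = 0
listCode (x ∷ xs) = suc (pair x (listCode xs))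

listCode-injective : ∀ xs ys → listCode xs ≡ listCode ys → xs ≡ ys
listCode-injective []       []       eq = refl
listCode-injective (x ∷ xs) (y ∷ ys) eq =
  let p , q = pair-injective x (listCode xs) y (listCode ys) (suc-injective eq)
  in cong₂ _∷_ p (listCode-injective xs ys q)

-- Sequences whose terms may depend on all earlier terms

module History {A : Set} (next : ℕ → List A → A) where

  hist : ℕ → List A
  hist zero    = []
  hist (suc n) = next n (hist n) ∷ hist n

  item : ℕ → A
  item n = next n (hist n)

  item∈hist : ∀ {m n} → m < n → item m ∈ hist n
  item∈hist {m} {suc n} m<1+n with m<1+n⇒m<n∨m≡n m<1+n
  ... | inj₁ m<n  = there (item∈hist m<n)
  ... | inj₂ refl = here refl

  ∈hist⇒item : ∀ {x} n → x ∈ hist n → ∃[ m ] m < n × x ≡ item m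
  ∈hist⇒item (suc n) (here eq) = n , n<1+n n , eq
  ∈hist⇒item (suc n) (there p) =
    let m , m<n , eq = ∈hist⇒item n p in m , m<n⇒m<1+n m<n , eq

<-distinct⇒injective : {A : Set} (c : ℕ → A) → (∀ {m n} → m < n → c n ≢ c m) →
                       ∀ {m n} → c m ≡ c n → m ≡ n
<-distinct⇒injective c d {m} {n} eq with <-cmp m n
... | tri< m<n _ _ = contradiction (sym eq) (d m<n)
... | tri≈ _ m≡n _ = m≡n
... | tri> _ _ n<m = contradiction eq (d n<m)

false-iff⇒≡ : ∀ {a b} → (a ≡ false) ⇔ (b ≡ false) → a ≡ b
false-iff⇒≡ {false} {b}     iff = sym (to iff refl)
false-iff⇒≡ {true}  {true}  iff = refl
false-iff⇒≡ {true}  {false} iff = from iff refl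

-- Classical logic, least witnesses and Cantor-Schröder-Bernstein

module Classical (lem : LEM) where

  truth : Set → Bool
  truth A = [ const true , const false ]′ (lem A)

  truth⁺ : ∀ {A} → A → truth A ≡ true
  truth⁺ {A} a with lem A
  ... | inj₁ _  = refl
  ... | inj₂ ¬a = contradiction a ¬a

  truth⁻ : ∀ {A} → truth A ≡ true → A
  truth⁻ {A} eq with lem A
  ... | inj₁ a = a

  truth-cong : ∀ {A A′} → A ⇔ A′ → truth A ≡ truth A′
  truth-cong {A} {A′} iff with lem A | lem A′
  ... | inj₁ _  | inj₁ _   = refl
  ... | inj₂ _  | inj₂ _   = refl
  ... | inj₁ a  | inj₂ ¬a′ = contradiction (to iff a) ¬a′
  ... | inj₂ ¬a | inj₁ a′  = contradiction (from iff a′) ¬a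

  truth-cong⁻ : ∀ {A A′} → truth A ≡ truth A′ → A ⇔ A′
  truth-cong⁻ eq = mk⇔ (λ a → truth⁻ (trans (sym eq) (truth⁺ a)))
                       (λ a′ → truth⁻ (trans eq (truth⁺ a′)))

  truth-≡true : ∀ b → truth (b ≡ true) ≡ b
  truth-≡true true  = truth⁺ refl
  truth-≡true false with lem (false ≡ true)
  ... | inj₂ _ = refl

  ¬∀⇒∃¬ : {A : Set} {Q : A → Set} → ¬ (∀ x → Q x) → ∃[ x ] ¬ Q x
  ¬∀⇒∃¬ {A} {Q} ¬∀ with lem (∃[ x ] ¬ Q x)
  ... | inj₁ w  = w
  ... | inj₂ ¬w = contradiction (λ x → [ id , (λ ¬q → contradiction (x , ¬q) ¬w) ]′ (lem (Q x))) ¬∀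

  IsLeast : (ℕ → Set) → ℕ → Set
  IsLeast Q n = Q n × (∀ m → m < n → ¬ Q m)

  least : (Q : ℕ → Set) → ∀ n → Q n → ∃ (IsLeast Q)
  least Q = <-rec (λ n → Q n → ∃ (IsLeast Q)) λ n rec q →
    [ (λ (m , m<n , qm) → rec m<n qm)
    , (λ none → n , q , λ m m<n qm → none (m , m<n , qm)) ]′
    (lem (∃[ m ] m < n × Q m))

  least-unique : ∀ {Q Q′ : ℕ → Set} {m n} → (∀ k → Q k ⇔ Q′ k) → IsLeast Q m → IsLeast Q′ n → m ≡ n
  least-unique iff (qm , lm) (qn , ln) = ≤-antisym
    (≮⇒≥ λ n<m → lm _ n<m (from (iff _) qn))
    (≮⇒≥ λ m<n → ln _ m<n (to (iff _) qm))

  -- Cantor–Schröder–Bernstein for the quotients A/∼ and C/≈.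
  module CSB {A C : Set} (_∼_ : A → A → Set) (_≈′_ : C → C → Set) (eqv : IsEquivalence _≈′_)
    (φ : A → C) (φ-iff : ∀ a a′ → (a ∼ a′) ⇔ (φ a ≈′ φ a′))
    (ψ : C → A) (ψ-iff : ∀ c c′ → (c ≈′ c′) ⇔ (ψ c ∼ ψ c′))
    where

    private
      module C≈ = IsEquivalence eqv

      -- `∼` inherits the laws of an equivalence from `≈′` through `φ-iff`.
      ∼-refl : ∀ {a} → a ∼ a
      ∼-refl = from (φ-iff _ _) C≈.refl

      ∼-sym : ∀ {a b} → a ∼ b → b ∼ a
      ∼-sym p = from (φ-iff _ _) (C≈.sym (to (φ-iff _ _) p))

      ∼-trans : ∀ {a b c} → a ∼ b → b ∼ c → a ∼ c
      ∼-trans p q = from (φ-iff _ _) (C≈.trans (to (φ-iff _ _) p) (to (φ-iff _ _) q))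

    -- The backward orbit of a under φ and ψ stops in A.
    data Stops (a : A) : Set where
      root : ¬ (∃[ c ] ψ c ∼ a) → Stops a
      step : ∀ a′ → Stops a′ → ψ (φ a′) ∼ a → Stops a

    Stops-resp : ∀ {a b} → a ∼ b → Stops a → Stops b
    Stops-resp p (root none)   = root λ (c , q) → none (c , ∼-trans q (∼-sym p))
    Stops-resp p (step a′ s q) = step a′ s (∼-trans q p)

    -- Stopping elements go forward along `φ`, the others backward along `ψ`. A relation closed
    -- under both equivalences lets `matched-iff` serve for well-definedness, injectivity and
    -- surjectivity.
    Matched : A → C → Set
    Matched a c = (Stops a × φ a ≈′ c) ⊎ (¬ Stops a × ψ c ∼ a)

    match : ∀ a → ∃ (Matched a)
    match a with lem (Stops a) | lem (∃[ c ] ψ c ∼ a)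
    ... | inj₁ s  | _            = φ a , inj₁ (s , C≈.refl)
    ... | inj₂ ¬s | inj₁ (c , p) = c , inj₂ (¬s , p)
    -- An element without a `ψ`-preimage stops at once.
    ... | inj₂ ¬s | inj₂ none    = contradiction (root none) ¬s

    matched-iff : ∀ {a b c d} → Matched a c → Matched b d → (a ∼ b) ⇔ (c ≈′ d)
    matched-iff (inj₁ (_ , p)) (inj₁ (_ , q)) = mk⇔
      (λ r → C≈.trans (C≈.sym p) (C≈.trans (to (φ-iff _ _) r) q))
      (λ r → from (φ-iff _ _) (C≈.trans p (C≈.trans r (C≈.sym q))))
    matched-iff (inj₂ (_ , p)) (inj₂ (_ , q)) = mk⇔
      (λ r → from (ψ-iff _ _) (∼-trans p (∼-trans r (∼-sym q))))
      (λ r → ∼-trans (∼-sym p) (∼-trans (to (ψ-iff _ _) r) q))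
    -- Both sides fail: stopping is invariant under `∼`, and it passes from `a` to `ψ (φ a)`.
    matched-iff (inj₁ (s , p)) (inj₂ (¬s , q)) = mk⇔
      (λ r → contradiction (Stops-resp r s) ¬s)
      (λ r → contradiction (step _ s (∼-trans (to (ψ-iff _ _) (C≈.trans p r)) q)) ¬s)
    matched-iff (inj₂ (¬s , q)) (inj₁ (s , p)) = mk⇔
      (λ r → contradiction (Stops-resp (∼-sym r) s) ¬s)
      (λ r → contradiction (step _ s (∼-trans (to (ψ-iff _ _) (C≈.trans p (C≈.sym r))) q)) ¬s)

    match-surjective : ∀ c → ∃[ a ] proj₁ (match a) ≈′ c
    match-surjective c with lem (Stops (ψ c))
    -- `ψ c` has the preimage `c`, so its orbit can stop only through an earlier element, and that
    -- element is matched with `c`.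
    ... | inj₁ (root none) = contradiction (c , ∼-refl) none
    ... | inj₁ (step a s p) = a , to (matched-iff (proj₂ (match a)) (inj₁ (s , from (ψ-iff _ _) p))) ∼-refl
    ... | inj₂ ¬s = ψ c , to (matched-iff (proj₂ (match (ψ c))) (inj₂ (¬s , ∼-refl))) ∼-refl

    bijection : Σ (A → C) λ χ → (∀ a b → (a ∼ b) ⇔ (χ a ≈′ χ b)) × (∀ c → ∃[ a ] χ a ≈′ c)
    bijection = proj₁ ∘ match
              , (λ a b → matched-iff (proj₂ (match a)) (proj₂ (match b)))
              , match-surjective

≈C-isEquivalence : IsEquivalence _≈C_
≈C-isEquivalence = record
  { refl = λ _ → refl ; sym = λ p n → sym (p n) ; trans = λ p q n → trans (p n) (q n) }

-- Green's relations between regular endomorphisms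

module Green {G : Str ℕ} where

  SameImage : End G → End G → Set
  SameImage f g = ∀ y → InImage f y ⇔ InImage g y

  SameKernel : End G → End G → Set
  SameKernel f g = ∀ x y → (fun f x ≡ fun f y) ⇔ (fun g x ≡ fun g y)

  idEnd : End G
  idEnd = mkEnd id (λ _ _ → id) (λ _ _ → id)

  ℒ⇒SameImage : (f g : End G) → f ℒ g → SameImage f g
  ℒ⇒SameImage f g ((a , f≈ag) , (b , g≈bf)) y = mk⇔
    (λ (x , eq) → fun a x , trans (sym (f≈ag x)) eq)
    (λ (x , eq) → fun b x , trans (sym (g≈bf x)) eq)

  ℛ⇒SameKernel : (f g : End G) → f ℛ g → SameKernel f g
  ℛ⇒SameKernel f g ((a , f≈ga) , (b , g≈fb)) x y = mk⇔
    (λ eq → trans (g≈fb x) (trans (cong (fun b) eq) (sym (g≈fb y))))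
    (λ eq → trans (f≈ga x) (trans (cong (fun a) eq) (sym (f≈ga y))))

  -- If `g l g = g`, then `l ⨾ g` fixes the image of `g` pointwise, so `f = f l g` whenever the
  -- image of `f` lies in that of `g`.
  SameImage⇒ℒ : (f g : End G) → Regular f → Regular g → SameImage f g → f ℒ g
  SameImage⇒ℒ f g (k , fkf) (l , glg) same =
      (f ⨾ l , λ x → half g l glg (to (same _) (x , refl)))
    , (g ⨾ k , λ x → half f k fkf (from (same _) (x , refl)))
    where
    half : (h m : End G) → (h ⨾ m ⨾ h) ≈ h → ∀ {y} → InImage h y → y ≡ fun h (fun m y)
    half h m hmh (z , refl) = sym (hmh z)

  -- If `g l g = g`, then `g` identifies `x` with `l (g x)`; hence so does `f`, which gives
  -- `f = g l f`.
  SameKernel⇒ℛ : (f g : End G) → Regular f → Regular g → SameKernel f g → f ℛ g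
  SameKernel⇒ℛ f g (k , fkf) (l , glg) same =
      (l ⨾ f , λ x → sym (from (same _ _) (glg x)))
    , (k ⨾ g , λ x → sym (to (same _ _) (fkf x)))

  ℒ-regular : (f h : End G) → f ℒ h → Regular f → Regular h
  ℒ-regular f h ((a , f≈ah) , (b , h≈bf)) (k , fkf) = k ⨾ a , λ x → begin
    fun h (fun a (fun k (fun h x)))         ≡⟨ f≈ah _ ⟨
    fun f (fun k (fun h x))                 ≡⟨ cong (fun f ∘ fun k) (h≈bf x) ⟩
    fun f (fun k (fun f (fun b x)))         ≡⟨ fkf _ ⟩
    fun f (fun b x)                         ≡⟨ h≈bf x ⟨
    fun h x                                 ∎
    where open ≡-Reasoning

  ℛ-regular : (h g : End G) → h ℛ g → Regular h → Regular g
  ℛ-regular h g ((a , h≈ga) , (b , g≈hb)) (k , hkh) = a ⨾ k , λ x → begin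
    fun g (fun k (fun a (fun g x)))         ≡⟨ cong (fun g ∘ fun k) (h≈ga x) ⟨
    fun g (fun k (fun h x))                 ≡⟨ g≈hb _ ⟩
    fun b (fun h (fun k (fun h x)))         ≡⟨ cong (fun b) (hkh x) ⟩
    fun b (fun h x)                         ≡⟨ g≈hb x ⟨
    fun g x                                 ∎
    where open ≡-Reasoning

  -- Regularity spreads over the whole 𝒟-class, so images and kernels classify all of its members.
  𝒟-regular : (f g : End G) → f 𝒟 g → Regular f → Regular g
  𝒟-regular f g (h , fℒh , hℛg) = ℛ-regular h g hℛg ∘ ℒ-regular f h fℒh

  -- The intermediate `h` has the image of `f`, and `b` maps that image onto the image of `g`.
  𝒟-finite : (f g : End G) → f 𝒟 g → FiniteImage f → FiniteImage g
  𝒟-finite f g (h , fℒh , (_ , (b , g≈hb))) (ys , bound) =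
    map (fun b) ys , λ { _ (x , refl) → subst (_∈ map (fun b) ys) (sym (g≈hb x))
      (∈-map⁺ (fun b) (bound _ (from (ℒ⇒SameImage f h fℒh _) (x , refl)))) }

  -- Since `b` undoes `a` on the image of `f`, the new map is ℛ-related to `f`: the kernel stays and
  -- the image may move.
  postcompose-𝒟 : (f a b : End G) → (∀ x → fun b (fun a (fun f x)) ≡ fun f x) → f 𝒟 (f ⨾ a)
  postcompose-𝒟 f a b baf = f
    , ((idEnd , λ _ → refl) , (idEnd , λ _ → refl))
    , ((b , sym ∘ baf) , (a , λ _ → refl))

  -- Dually, `a` recovers `f` from `b ⨾ f`, so the two are ℒ-related: the image stays and the kernel
  -- may change.
  precompose-𝒟 : (f a b : End G) → (∀ x → fun b (fun a x) ≡ x) → f 𝒟 (b ⨾ f)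
  precompose-𝒟 f a b ba = b ⨾ f
    , ((a , λ x → cong (fun f) (sym (ba x))) , (b , λ _ → refl))
    , ((idEnd , λ _ → refl) , (idEnd , λ _ → refl))

  module ClassesOf (f : End G) (reg : Regular f) where

    regular : (g : DClass f) → Regular (proj₁ g)
    regular (g , d) = 𝒟-regular f g d reg

    ℒ⇔SameImage : (g h : DClass f) → (proj₁ g ℒ proj₁ h) ⇔ SameImage (proj₁ g) (proj₁ h)
    ℒ⇔SameImage g h = mk⇔ (ℒ⇒SameImage (proj₁ g) (proj₁ h)) (SameImage⇒ℒ (proj₁ g) (proj₁ h) (regular g) (regular h))

    ℛ⇔SameKernel : (g h : DClass f) → (proj₁ g ℛ proj₁ h) ⇔ SameKernel (proj₁ g) (proj₁ h)
    ℛ⇔SameKernel g h = mk⇔ (ℛ⇒SameKernel (proj₁ g) (proj₁ h)) (SameKernel⇒ℛ (proj₁ g) (proj₁ h) (regular g) (regular h))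

  -- Invariants of images and kernels in Cantor space and in ℕ

  module Codes (lem : LEM) where
    open Classical lem

    imageCode : End G → Cantor
    imageCode g y = truth (InImage g y)

    imageCode-iff : ∀ g h → SameImage g h ⇔ (imageCode g ≈C imageCode h)
    imageCode-iff g h = mk⇔ (λ s y → truth-cong (s y)) (λ eq y → truth-cong⁻ (eq y))

    KernelCoded : End G → ℕ → Set
    KernelCoded g n = ∃[ x ] ∃[ y ] pair x y ≡ n × fun g x ≡ fun g y

    kernelCode : End G → Cantor
    kernelCode g n = truth (KernelCoded g n)

    kernelCode-iff : ∀ g h → SameKernel g h ⇔ (kernelCode g ≈C kernelCode h)
    kernelCode-iff g h = mk⇔
      (λ s n → truth-cong (mk⇔ (λ (x , y , p , q) → x , y , p , to (s x y) q)
                               (λ (x , y , p , q) → x , y , p , from (s x y) q)))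
      (λ eq x y → mk⇔ (λ q → decode h x y (to (truth-cong⁻ (eq (pair x y))) (x , y , refl , q)))
                      (λ q → decode g x y (from (truth-cong⁻ (eq (pair x y))) (x , y , refl , q))))
      where
      decode : ∀ k x y → KernelCoded k (pair x y) → fun k x ≡ fun k y
      decode k x y (x′ , y′ , p , q) with refl , refl ← pair-injective x′ y′ x y p = q

    Lists : End G → ℕ → Set
    Lists g n = ∃[ ys ] listCode ys ≡ n × (∀ y → InImage g y ⇔ y ∈ ys)

    -- A witness of `FiniteImage` only bounds the image; excluded middle prunes the points outside
    -- it.
    exactList : ∀ g → FiniteImage g → ∃ (Lists g)
    exactList g (ys , bound) =
      let zs , iff = prune ys
      in listCode zs , zs , refl , λ y → mk⇔ (λ i → from (iff y) (bound y i , i)) (λ m → proj₂ (to (iff y) m))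
      where
      prune : ∀ ys → ∃[ zs ] (∀ y → y ∈ zs ⇔ (y ∈ ys × InImage g y))
      prune [] = [] , λ y → mk⇔ (λ ()) (λ ())
      prune (x ∷ ys) with prune ys | lem (InImage g x)
      ... | zs , iff | inj₁ i = x ∷ zs , λ y → mk⇔
        (λ { (here refl) → here refl , i ; (there m) → let p , q = to (iff y) m in there p , q })
        (λ { (here refl , _) → here refl ; (there m , q) → there (from (iff y) (m , q)) })
      ... | zs , iff | inj₂ ¬i = zs , λ y → mk⇔
        (λ m → let p , q = to (iff y) m in there p , q)
        (λ { (here refl , q) → contradiction q ¬i ; (there m , q) → from (iff y) (m , q) })

    -- One image has many listings; the least code depends on the image alone.
    finiteImageCode : ∀ g → FiniteImage g → ∃ (IsLeast (Lists g))
    finiteImageCode g fin = let n , l = exactList g fin in least (Lists g) n l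

    leastList-iff : ∀ g h {m n} → IsLeast (Lists g) m → IsLeast (Lists h) n → SameImage g h ⇔ m ≡ n
    leastList-iff g h lm ln = mk⇔
      (λ s → least-unique (λ k → mk⇔
        (λ (ys , eq , iff) → ys , eq , λ y → iff y ⇔-∘ ⇔-sym (s y))
        (λ (ys , eq , iff) → ys , eq , λ y → iff y ⇔-∘ s y)) lm ln)
      (back (proj₁ lm) (proj₁ ln))
      where
      back : ∀ {m n} → Lists g m → Lists h n → m ≡ n → SameImage g h
      back (ys , p , iff) (zs , q , iff′) eq y
        with refl ← listCode-injective ys zs (trans p (trans eq (sym q))) = ⇔-sym (iff′ y) ⇔-∘ iff y

-- Copies of countable bipartite graphs in B

module Universal (lem : LEM) (B : Str ℕ) (part : ℕ → Bool)
  (bip : IsBipartiteWith B part) (ext : ExtensionProperty B part) where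

  open Classical lem
  open Green {B}
  open Codes lem

  private
    _~_ : ℕ → ℕ → Set
    _~_ = E B

  ~-irrefl : ∀ x → ¬ x ~ x
  ~-irrefl = proj₁ bip

  ~-sym : ∀ {x y} → x ~ y → y ~ x
  ~-sym = proj₁ (proj₂ bip) _ _

  P⇔part : ∀ {x y} → P B x y ⇔ (part x ≡ part y)
  P⇔part = proj₁ (proj₂ (proj₂ bip)) _ _

  ~⇒part≢ : ∀ {x y} → x ~ y → part x ≢ part y
  ~⇒part≢ e eq = proj₂ (proj₂ (proj₂ bip)) _ _ e (from P⇔part eq)

  partPreserving : (h : ℕ → ℕ) → (∀ x y → x ~ y → h x ~ h y) → (∀ x → part (h x) ≡ part x) → End B
  partPreserving h hE hp = mkEnd h hE λ x y p →
    from P⇔part (trans (hp x) (trans (to P⇔part p) (sym (hp y))))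

  part-image-cong : (f : End B) → ∀ {x y} → part x ≡ part y → part (fun f x) ≡ part (fun f y)
  part-image-cong f eq = to P⇔part (presP f _ _ (from P⇔part eq))

  -- Adjacency to all of `xs` in the other part is always an admissible demand. Such vertices serve
  -- as values that satisfy any finite set of edge conditions.
  dominator : ∀ xs c → ∃[ v ] part v ≡ c × (∀ x → x ∈ xs → part x ≢ c → v ~ x)
  dominator xs c =
    let v , _ , pv , adj = ext xs c (λ x → truth (part x ≢ c)) (λ _ _ → truth⁻)
    in v , pv , λ x m ne → from (adj x m) (truth⁺ ne)

  -- If `x` and `y` lay in different parts, a neighbour `v` of `x` in the part of `y` would be sent
  -- to a neighbour of `f x` in the part of `f y`.
  part-image-reflects : (f : End B) → ∀ {x y} → part (fun f x) ≡ part (fun f y) → part x ≡ part y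
  part-image-reflects f {x} {y} eq with part x ≟ᵇ part y
  ... | yes p = p
  ... | no ne =
    let v , pv , adj = dominator (x ∷ []) (part y)
    in contradiction (trans (part-image-cong f pv) (sym eq))
                     (~⇒part≢ (presE f _ _ (adj x (here refl) ne)))

  -- A bipartite graph with named sides, loops being excluded by `⌢-sides`. `IsHom` demands the
  -- named side itself, not just that the partition be respected.
  record Pattern (I : Set) : Set₁ where
    field
      side    : I → Bool
      _⌢_     : I → I → Set
      ⌢-sym   : ∀ {i j} → i ⌢ j → j ⌢ i
      ⌢-sides : ∀ {i j} → i ⌢ j → side i ≢ side j

    IsHom : (I → ℕ) → Set
    IsHom ρ = (∀ i → part (ρ i) ≡ side i) × (∀ i j → i ⌢ j → ρ i ~ ρ j)

  -- `extend-cong` makes the extension a function of the pointwise values of `ρ`, as sequences and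
  -- endomorphisms are compared pointwise.
  record FreeCopy {I : Set} (𝒫 : Pattern I) : Set₁ where
    open Pattern 𝒫
    field
      point           : I → ℕ
      point-injective : ∀ {i j} → point i ≡ point j → i ≡ j
      point-part      : ∀ i → part (point i) ≡ side i
      point-edge      : ∀ {i j} → i ⌢ j → point i ~ point j
      extend          : ∀ ρ → IsHom ρ → Σ (End B) λ b → ∀ i → fun b (point i) ≡ ρ i
      extend-cong     : ∀ ρ ρ′ (hom : IsHom ρ) (hom′ : IsHom ρ′) → (∀ i → ρ i ≡ ρ′ i) →
                        proj₁ (extend ρ hom) ≈ proj₁ (extend ρ′ hom′)

  module FreeCopyℕ (𝒫 : Pattern ℕ) where
    open Pattern 𝒫

    -- The last conjunct makes the demand admissible for the extension property whatever the list
    -- `s` contains.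
    Joined : ℕ → List (ℕ × ℕ) → ℕ → Set
    Joined k s x = ∃[ j ] (j , x) ∈ s × k ⌢ j × part x ≢ side k

    -- Adding `0, …, k` keeps the `k`-th point nonadjacent to every vertex up to and including `k`
    -- outside the copy. Including `k` gives the strict bound in `outside-finite`.
    avoid : ℕ → List (ℕ × ℕ) → List ℕ
    avoid k s = map proj₂ s ++ upTo (suc k)

    newPoint : ∀ k s → ∃[ v ] v ∉ avoid k s × part v ≡ side k
                       × (∀ x → x ∈ avoid k s → v ~ x ⇔ truth (Joined k s x) ≡ true)
    newPoint k s = ext (avoid k s) (side k) (λ x → truth (Joined k s x))
      λ x _ t → proj₂ (proj₂ (proj₂ (truth⁻ t)))

    open History (λ k s → k , proj₁ (newPoint k s))

    c : ℕ → ℕ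
    c k = proj₁ (newPoint k (hist k))

    c-part : ∀ k → part (c k) ≡ side k
    c-part k = proj₁ (proj₂ (proj₂ (newPoint k (hist k))))

    earlier∈avoid : ∀ {j k} → j < k → c j ∈ avoid k (hist k)
    earlier∈avoid j<k = ∈-++⁺ˡ (∈-map⁺ proj₂ (item∈hist j<k))

    c-adj : ∀ k x → x ∈ avoid k (hist k) → c k ~ x ⇔ Joined k (hist k) x
    c-adj k x m = mk⇔ (λ e → truth⁻ (to iff e)) (λ q → from iff (truth⁺ q))
      where iff = proj₂ (proj₂ (proj₂ (newPoint k (hist k)))) x m

    c-injective : ∀ {i j} → c i ≡ c j → i ≡ j
    c-injective = <-distinct⇒injective c λ {m} {n} m<n eq →
      proj₁ (proj₂ (newPoint n (hist n))) (subst (_∈ avoid n (hist n)) (sym eq) (earlier∈avoid m<n))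

    joined⇒earlier : ∀ {k x} → Joined k (hist k) x → ∃[ j ] x ≡ c j × k ⌢ j
    joined⇒earlier {k} (j , m , r , _) with _ , _ , refl ← ∈hist⇒item k m = j , refl , r

    c-edge-< : ∀ {j k} → j < k → c k ~ c j ⇔ k ⌢ j
    c-edge-< {j} {k} j<k = mk⇔
      (λ e → let i , eq , r = joined⇒earlier (to iff e)
             in subst (k ⌢_) (sym (c-injective eq)) r)
      (λ r → from iff (j , item∈hist j<k , r ,
                       λ eq → ⌢-sides r (trans (sym eq) (c-part j))))
      where iff = c-adj k (c j) (earlier∈avoid j<k)

    c-edge : ∀ {i j} → c i ~ c j ⇔ i ⌢ j
    c-edge {i} {j} with <-cmp i j
    ... | tri< i<j _ _ = mk⇔ (λ e → ⌢-sym (to (c-edge-< i<j) (~-sym e)))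
                             (λ r → ~-sym (from (c-edge-< i<j) (⌢-sym r)))
    ... | tri≈ _ refl _ = mk⇔ (λ e → contradiction e (~-irrefl _)) (λ r → contradiction refl (⌢-sides r))
    ... | tri> _ _ j<i = c-edge-< j<i

    InCopy : ℕ → Set
    InCopy v = ∃[ k ] c k ≡ v

    -- This sparsity is what makes homomorphisms on the copy extend.
    outside-finite : ∀ {v k} → ¬ InCopy v → v ~ c k → k < v
    outside-finite {v} {k} out e with k <? v
    ... | yes k<v = k<v
    ... | no k≮v =
      let j , eq , _ = joined⇒earlier (to (c-adj k v (∈-++⁺ʳ (map proj₂ (hist k)) (∈-upTo⁺ (s≤s (≮⇒≥ k≮v))))) (~-sym e))
      in contradiction (j , sym eq) out

    module Extension (ρ : ℕ → ℕ) (hom : IsHom ρ) where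

      ρ-part = proj₁ hom
      ρ-edge = proj₂ hom

      seen : List (ℕ × ℕ) → List ℕ
      seen s = map proj₁ s ++ map proj₂ s

      -- Outside the copy, `v` goes to a dominator of all `b u` and all prescribed `ρ u` with
      -- `u < v`; the latter cover its neighbours in the copy, whose indices are below `v`.
      value : ℕ → List (ℕ × ℕ) → ℕ
      value v s = [ (λ (k , _) → ρ k) , (λ _ → proj₁ (dominator (seen s) (part v))) ]′ (lem (InCopy v))

      module Values = History (λ v s → value v s , ρ v)

      b : ℕ → ℕ
      b v = value v (Values.hist v)

      b-c : ∀ k → b (c k) ≡ ρ k
      b-c k with lem (InCopy (c k))
      ... | inj₁ (_ , eq) = cong ρ (c-injective eq)
      ... | inj₂ none     = contradiction (k , refl) none

      b-part : ∀ v → part (b v) ≡ part v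
      b-part v with lem (InCopy v)
      ... | inj₁ (k , refl) = trans (ρ-part k) (sym (c-part k))
      ... | inj₂ _ = proj₁ (proj₂ (dominator _ (part v)))

      b-outside : ∀ {v} → ¬ InCopy v → ∀ {x} → x ∈ seen (Values.hist v) → part x ≢ part v → b v ~ x
      b-outside {v} out m ne with lem (InCopy v)
      ... | inj₁ i = contradiction i out
      ... | inj₂ _ = proj₂ (proj₂ (dominator _ (part v))) _ m ne

      b-outside-< : ∀ {u v} → ¬ InCopy v → u < v → v ~ u → b v ~ b u
      b-outside-< {u} {v} out u<v e = b-outside out
        (∈-++⁺ˡ (∈-map⁺ proj₁ (Values.item∈hist u<v)))
        (λ eq → ~⇒part≢ e (trans (sym eq) (b-part u)))

      b-outside-c : ∀ {v} k → ¬ InCopy v → v ~ c k → b v ~ b (c k)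
      b-outside-c {v} k out e = subst (b v ~_) (sym (b-c k)) (b-outside out
        (∈-++⁺ʳ (map proj₁ (Values.hist v)) (∈-map⁺ proj₂ (Values.item∈hist (outside-finite out e))))
        (λ eq → ~⇒part≢ e (trans (sym eq) (trans (ρ-part k) (sym (c-part k))))))

      -- Inside the copy edges of `B` come from the pattern. Of two outside vertices the larger
      -- dominates; between outside and copy the outside one does, even if the copy vertex is the
      -- larger number.
      b-edge : ∀ u v → u ~ v → b u ~ b v
      b-edge u v e = by-cases (lem (InCopy u)) (lem (InCopy v))
        where
        outside : ¬ InCopy u → ¬ InCopy v → b u ~ b v
        outside out out′ with <-cmp u v
        ... | tri< u<v _ _ = ~-sym (b-outside-< out′ u<v (~-sym e))
        ... | tri≈ _ u≡v _ = contradiction (cong part u≡v) (~⇒part≢ e)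
        ... | tri> _ _ v<u = b-outside-< out v<u e

        by-cases : InCopy u ⊎ ¬ InCopy u → InCopy v ⊎ ¬ InCopy v → b u ~ b v
        by-cases (inj₁ (i , refl)) (inj₁ (j , refl)) =
          subst₂ _~_ (sym (b-c i)) (sym (b-c j)) (ρ-edge i j (to c-edge e))
        by-cases (inj₁ (i , refl)) (inj₂ out) = ~-sym (b-outside-c i out (~-sym e))
        by-cases (inj₂ out) (inj₁ (j , refl)) = b-outside-c j out e
        by-cases (inj₂ out) (inj₂ out′) = outside out out′

    module _ (ρ ρ′ : ℕ → ℕ) (hom : IsHom ρ) (hom′ : IsHom ρ′) (eq : ∀ i → ρ i ≡ ρ′ i) where
      private
        module X = Extension ρ hom
        module Y = Extension ρ′ hom′

      -- Membership in the copy does not involve `ρ`, and outside the copy the value depends on the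
      -- history only.
      value-cong : ∀ v s → X.value v s ≡ Y.value v s
      value-cong v s with lem (InCopy v)
      ... | inj₁ (k , _) = eq k
      ... | inj₂ _       = refl

      mutual
        hist-cong : ∀ v → X.Values.hist v ≡ Y.Values.hist v
        hist-cong zero    = refl
        hist-cong (suc v) = cong₂ _∷_ (cong₂ _,_ (b-cong v) (eq v)) (hist-cong v)

        b-cong : ∀ v → X.b v ≡ Y.b v
        b-cong v = trans (value-cong v (X.Values.hist v)) (cong (Y.value v) (hist-cong v))

    freeCopy : FreeCopy 𝒫
    freeCopy = record
      { point = c ; point-injective = c-injective ; point-part = c-part ; point-edge = from c-edge
      ; extend = λ ρ hom → partPreserving (Extension.b ρ hom) (Extension.b-edge ρ hom) (Extension.b-part ρ hom)
                         , Extension.b-c ρ hom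
      ; extend-cong = b-cong }

  abstract
    -- In the applications the indices with bit `false` carry a copy of `B`, and those with bit
    -- `true` are the added vertices.
    freeCopy : (𝒫 : Pattern (ℕ × Bool)) → FreeCopy 𝒫
    freeCopy 𝒫 = record
      { point = point ∘ enc
      ; point-injective = λ eq → enc-injective (point-injective eq)
      ; point-part = λ i → trans (point-part (enc i)) (cong side (dec-enc i))
      ; point-edge = λ {i} {j} r → point-edge (subst₂ _⌢_ (sym (dec-enc i)) (sym (dec-enc j)) r)
      ; extend = λ ρ hom → let b , b-point = extend (ρ ∘ dec) (reindexedHom hom)
                           in b , λ i → trans (b-point (enc i)) (cong ρ (dec-enc i))
      ; extend-cong = λ ρ ρ′ hom hom′ eq →
          extend-cong (ρ ∘ dec) (ρ′ ∘ dec) (reindexedHom hom) (reindexedHom hom′) (eq ∘ dec) }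
      where
      open Pattern 𝒫
      reindexed : Pattern ℕ
      reindexed = record
        { side = side ∘ dec ; _⌢_ = λ i j → dec i ⌢ dec j ; ⌢-sym = ⌢-sym ; ⌢-sides = ⌢-sides }
      open FreeCopy (FreeCopyℕ.freeCopy reindexed)
      reindexedHom : ∀ {ρ} → IsHom ρ → Pattern.IsHom reindexed (ρ ∘ dec)
      reindexedHom (ρ-part , ρ-edge) = ρ-part ∘ dec , λ i j → ρ-edge (dec i) (dec j)

  -- Blow-ups of B: changing the image within a 𝒟-class

  pullback : (ℕ × Bool → ℕ) → Pattern (ℕ × Bool)
  pullback ρ = record
    { side = part ∘ ρ ; _⌢_ = λ i j → ρ i ~ ρ j ; ⌢-sym = ~-sym ; ⌢-sides = ~⇒part≢ }

  module ImageChange (f : End B) (reg : Regular f) (ρ : ℕ × Bool → ℕ) where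
    open FreeCopy (freeCopy (pullback ρ))
    open ClassesOf f reg

    Section : Set
    Section = Σ (ℕ → ℕ × Bool) λ s → ∀ n → ρ (s n) ≡ n

    embedding : Section → End B
    embedding (s , ρs) = partPreserving (point ∘ s)
      (λ x y e → point-edge (subst₂ _~_ (sym (ρs x)) (sym (ρs y)) e))
      (λ x → trans (point-part (s x)) (cong part (ρs x)))

    moved : Section → DClass f
    moved σ@(s , ρs) = f ⨾ embedding σ ,
      -- `ρ` is a homomorphism on its own pullback, and its extension undoes the embedding given by
      -- any section.
      let b , b-point = extend ρ ((λ _ → refl) , λ _ _ → id)
      in postcompose-𝒟 f (embedding σ) b λ x → trans (b-point (s (fun f x))) (ρs (fun f x))

    -- A point of the image reveals its index, and `ρ` of the index reveals the vertex of the image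
    -- of `f` from which it came. So equal images force the sections to agree there.
    moved-image : ∀ σ τ → (∀ x → proj₁ σ (fun f x) ≡ proj₁ τ (fun f x)) ⇔
                          SameImage (proj₁ (moved σ)) (proj₁ (moved τ))
    moved-image σ@(s , ρs) τ@(t , ρt) = mk⇔
      (λ eq y → mk⇔ (λ (x , p) → x , trans (cong point (sym (eq x))) p)
                    (λ (x , p) → x , trans (cong point (eq x)) p))
      agree
      where
      agree : SameImage (proj₁ (moved σ)) (proj₁ (moved τ)) → ∀ x → s (fun f x) ≡ t (fun f x)
      agree same x = let z , p = to (same _) (x , refl)
                         q = point-injective p
                         w = trans (sym (ρt _)) (trans (cong ρ q) (ρs _))
                     in trans (sym q) (cong t w)

    moved-ℒ : ∀ σ τ → (∀ x → proj₁ σ (fun f x) ≡ proj₁ τ (fun f x)) ⇔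
                      (proj₁ (moved σ) ℒ proj₁ (moved τ))
    moved-ℒ σ τ = ⇔-sym (ℒ⇔SameImage (moved σ) (moved τ)) ⇔-∘ moved-image σ τ

  -- Greedy choice: if no new point were available, the finite list of earlier ones would bound the
  -- image.
  infinitePoints : (f : End B) → InfiniteImage f →
                   Σ (ℕ → ℕ) λ θ → (∀ {m n} → θ m ≡ θ n → m ≡ n) × (∀ n → InImage f (θ n))
  infinitePoints f inf = item , <-distinct⇒injective item distinct , λ n → proj₁ (proj₂ (fresh (hist n)))
    where
    fresh : ∀ ys → ∃[ y ] InImage f y × y ∉ ys
    fresh ys = let x , nx = ¬∀⇒∃¬ {Q = λ x → fun f x ∈ ys} λ all → inf (ys , λ { _ (x , refl) → all x })
               in fun f x , (x , refl) , nx
    open History (λ _ ys → proj₁ (fresh ys))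
    distinct : ∀ {m n} → m < n → item n ≢ item m
    distinct {n = n} m<n eq =
      proj₂ (proj₂ (fresh (hist n))) (subst (_∈ hist n) (sym eq) (item∈hist m<n))

  -- Counting ℒ-classes and ℛ-classes

  module Counting (f : End B) (reg : Regular f) where
    open ClassesOf f reg

    private
      ℒ′ ℛ′ : DClass f → DClass f → Set
      ℒ′ g h = proj₁ g ℒ proj₁ h
      ℛ′ g h = proj₁ g ℛ proj₁ h

    ℒ-continuum : InfiniteImage f → NumClassesInD _ℒ_ f Cantor _≈C_
    ℒ-continuum inf = CSB.bijection ℒ′ _≈C_ ≈C-isEquivalence
      (imageCode ∘ proj₁) (λ g h → imageCode-iff (proj₁ g) (proj₁ h) ⇔-∘ ℒ⇔SameImage g h)
      (moved ∘ section)
      (λ α β → moved-ℒ (section α) (section β) ⇔-∘ mk⇔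
        (λ eq x → cong (fun f x ,_) (truth-cong (mk⇔
          (λ (n , p , q) → n , p , trans (sym (eq n)) q)
          (λ (n , p , q) → n , p , trans (eq n) q))))
        (λ eq n → let x , p = θ-image n in
          trans (sym (choice-θ α n))
            (trans (subst (λ w → choice α w ≡ choice β w) p (,-injectiveʳ (eq x))) (choice-θ β n))))
      where
      -- Every vertex is doubled; `α n` selects the copy of `θ n`, with `false` as default off the
      -- range of `θ`.
      open ImageChange f reg proj₁
      θ = proj₁ (infinitePoints f inf)
      θ-injective = proj₁ (proj₂ (infinitePoints f inf))
      θ-image = proj₂ (proj₂ (infinitePoints f inf))
      choice : Cantor → ℕ → Bool
      choice α w = truth (∃[ n ] θ n ≡ w × α n ≡ true)
      choice-θ : ∀ α n → choice α (θ n) ≡ α n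
      choice-θ α n = trans
        (truth-cong (mk⇔ (λ (m , p , q) → trans (cong α (sym (θ-injective p))) q) (λ q → n , refl , q)))
        (truth-≡true (α n))
      section : Cantor → Section
      section α = (λ w → w , choice α w) , λ _ → refl

    ℒ-countable : FiniteImage f → NumClassesInD _ℒ_ f ℕ _≡_
    ℒ-countable fin = CSB.bijection ℒ′ _≡_ isEquivalence
      (λ g → proj₁ (code g))
      (λ g h → leastList-iff (proj₁ g) (proj₁ h) (proj₂ (code g)) (proj₂ (code h)) ⇔-∘ ℒ⇔SameImage g h)
      (moved ∘ section)
      (λ m n → moved-ℒ (section m) (section n) ⇔-∘ mk⇔
        (λ eq x → cong (λ k → choice k (fun f x)) eq)
        (λ eq → ,-injectiveˡ (trans (sym (choice-w m)) (trans (eq 0) (choice-w n)))))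
      where
      -- Only this one vertex is multiplied, and section `m` selects its copy `(m , true)`. It lies
      -- in the image of `f`, so evaluation at `0` recovers `m`.
      w = fun f 0
      code : ∀ (g : DClass f) → ∃ (IsLeast (Lists (proj₁ g)))
      code (g , d) = finiteImageCode g (𝒟-finite f g d fin)
      ρ : ℕ × Bool → ℕ
      ρ (n , false) = n
      ρ (_ , true)  = w
      open ImageChange f reg ρ
      choice : ℕ → ℕ → ℕ × Bool
      choice m n with n ≟ w
      ... | yes _ = m , true
      ... | no _  = n , false
      ρ-choice : ∀ m n → ρ (choice m n) ≡ n
      ρ-choice m n with n ≟ w
      ... | yes p = sym p
      ... | no _  = refl
      choice-w : ∀ m → choice m w ≡ (m , true)
      choice-w m with w ≟ w
      ... | yes _ = refl
      ... | no ne = contradiction refl ne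
      section : ℕ → Section
      section m = choice m , ρ-choice m

    -- Collapsing an independent set: changing the kernel within a 𝒟-class

    module _ {w₀ w₁ : ℕ} (same-part : part w₀ ≡ part w₁) (f-separates : fun f w₀ ≢ fun f w₁) where

      isolated : Pattern (ℕ × Bool)
      isolated = record
        { side = side ; _⌢_ = _⌢_
        ; ⌢-sym = λ { {_ , false} {_ , false} → ~-sym }
        ; ⌢-sides = λ { {_ , false} {_ , false} → ~⇒part≢ } }
        where
        side : ℕ × Bool → Bool
        side (n , false) = part n
        side (_ , true)  = part w₀
        _⌢_ : ℕ × Bool → ℕ × Bool → Set
        (m , false) ⌢ (n , false) = m ~ n
        _           ⌢ _           = ⊥

      open FreeCopy (freeCopy isolated)

      pick : Bool → ℕ
      pick b = if b then w₁ else w₀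

      pick-part : ∀ b → part (pick b) ≡ part w₀
      pick-part true  = sym same-part
      pick-part false = refl

      pick-injective : ∀ a b → fun f (pick a) ≡ fun f (pick b) → a ≡ b
      pick-injective true  true  _  = refl
      pick-injective false false _  = refl
      pick-injective true  false eq = contradiction (sym eq) f-separates
      pick-injective false true  eq = contradiction eq f-separates

      -- Index `0` always goes to `w₀` and is the reference point; comparing index `suc n` with it
      -- in the kernel reads off `α n`.
      tagged : Cantor → ℕ → Bool
      tagged α zero    = false
      tagged α (suc n) = α n

      target : Cantor → ℕ × Bool → ℕ
      target α (n , false) = n
      target α (n , true)  = pick (tagged α n)

      target-hom : ∀ α → Pattern.IsHom isolated (target α)
      target-hom α = (λ { (_ , false) → refl ; (n , true) → pick-part (tagged α n) })
                   , (λ { (_ , false) (_ , false) → id })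

      collapse : ∀ α → Σ (End B) λ b → ∀ i → fun b (point i) ≡ target α i
      collapse α = extend (target α) (target-hom α)

      copy : End B
      copy = partPreserving (λ n → point (n , false)) (λ _ _ → point-edge) (λ n → point-part (n , false))

      collapsed : Cantor → DClass f
      collapsed α = let b , b-point = collapse α
        in b ⨾ f , precompose-𝒟 f copy b (λ n → b-point (n , false))

      collapsed-point : ∀ α i → fun (proj₁ (collapsed α)) (point i) ≡ fun f (target α i)
      collapsed-point α i = cong (fun f) (proj₂ (collapse α) i)

      target-cong : ∀ {α β} → α ≈C β → ∀ i → target α i ≡ target β i
      target-cong eq (_     , false) = refl
      target-cong eq (zero  , true)  = refl
      target-cong eq (suc n , true)  = cong pick (eq n)

      collapsed-cong : ∀ {α β} → α ≈C β → proj₁ (collapsed α) ≈ proj₁ (collapsed β)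
      collapsed-cong {α} {β} eq x = cong (fun f)
        (extend-cong (target α) (target β) (target-hom α) (target-hom β) (target-cong eq) x)

      collapsed-kernel : ∀ α n → (fun (proj₁ (collapsed α)) (point (suc n , true))
                                    ≡ fun (proj₁ (collapsed α)) (point (0 , true))) ⇔ (α n ≡ false)
      collapsed-kernel α n = mk⇔
        (λ eq → pick-injective (α n) false
          (trans (sym (collapsed-point α _)) (trans eq (collapsed-point α _))))
        (λ eq → trans (collapsed-point α _)
          (trans (cong (fun f ∘ pick) eq) (sym (collapsed-point α _))))

      collapsed-ℛ : ∀ α β → (α ≈C β) ⇔ ℛ′ (collapsed α) (collapsed β)
      collapsed-ℛ α β = ⇔-sym (ℛ⇔SameKernel (collapsed α) (collapsed β)) ⇔-∘ mk⇔
        (λ eq x y → mk⇔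
          (λ p → trans (sym (collapsed-cong eq x)) (trans p (collapsed-cong eq y)))
          (λ p → trans (collapsed-cong eq x) (trans p (sym (collapsed-cong eq y)))))
        (λ same n → false-iff⇒≡ (collapsed-kernel β n ⇔-∘ (same _ _ ⇔-∘ ⇔-sym (collapsed-kernel α n))))

      ℛ-continuum : NumClassesInD _ℛ_ f Cantor _≈C_
      ℛ-continuum = CSB.bijection ℛ′ _≈C_ ≈C-isEquivalence
        (kernelCode ∘ proj₁) (λ g h → kernelCode-iff (proj₁ g) (proj₁ h) ⇔-∘ ℛ⇔SameKernel g h)
        collapsed collapsed-ℛ

    ℛ-single : ImageIsoK11 f → NumClassesInD _ℛ_ f ⊤ _≡_
    ℛ-single (φ , _ , cover , _ , _ , φ-P) =
        const tt
      , (λ g h → mk⇔ (const refl) (const (from (ℛ⇔SameKernel g h) λ x y →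
          ⇔-sym (kernel h x y) ⇔-∘ kernel g x y)))
      , (λ _ → (f , f , ((idEnd , λ _ → refl) , (idEnd , λ _ → refl))
                      , ((idEnd , λ _ → refl) , (idEnd , λ _ → refl))) , refl)
      where
      -- The intermediate `h` shares the image of `f`, which has one vertex in each part. Hence the
      -- kernel of `h`, and so that of `g`, is the bipartition itself.
      kernel : (g : DClass f) → ∀ x y → (fun (proj₁ g) x ≡ fun (proj₁ g) y) ⇔ (part x ≡ part y)
      kernel (g , h , fℒh , hℛg) x y = kernel-h ⇔-∘ ⇔-sym (ℛ⇒SameKernel h g hℛg x y)
        where
        image : ∀ z → ∃[ b ] φ b ≡ fun h z
        image z = cover _ (from (ℒ⇒SameImage f h fℒh _) (z , refl))
        kernel-h : (fun h x ≡ fun h y) ⇔ (part x ≡ part y)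
        kernel-h = mk⇔ (part-image-reflects h ∘ cong part) λ eq →
          let b , p = image x
              c , q = image y
              b≡c = to (φ-P b c) (subst₂ (P B) (sym p) (sym q) (presP h x y (from P⇔part eq)))
          in trans (sym p) (trans (cong φ b≡c) q)

  -- Otherwise `f` is constant on each part, and its image consists of the two ends of the image of
  -- one edge.
  separated : (f : End B) → ¬ ImageIsoK11 f →
              ∃[ w₀ ] ∃[ w₁ ] part w₀ ≡ part w₁ × fun f w₀ ≢ fun f w₁
  separated f ¬K11 with lem (∃[ w₀ ] ∃[ w₁ ] part w₀ ≡ part w₁ × fun f w₀ ≢ fun f w₁)
  ... | inj₁ w = w
  ... | inj₂ none = contradiction
      ( fun f ∘ x
      , (λ b → x b , refl)
      , (λ { _ (z , refl) → part z , constant (x-part (part z)) })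
      , (λ b c eq → parts b c (cong part eq))
      , (λ b c → mk⇔ (λ { e refl → ~-irrefl _ e }) (λ ne → presE f _ _ (x-edge b c ne)))
      , (λ b c → mk⇔ (parts b c ∘ to P⇔part) (λ { refl → from P⇔part refl })) ) ¬K11
    where
    constant : ∀ {u v} → part u ≡ part v → fun f u ≡ fun f v
    constant {u} {v} eq with fun f u ≟ fun f v
    ... | yes p = p
    ... | no ne = contradiction (u , v , eq , ne) none
    x₀ = dominator [] false
    -- With `x₀` in part `false`, this choice yields an edge, whose image under `f` is the copy of
    -- `K11`.
    x₁ = dominator (proj₁ x₀ ∷ []) true
    x : Bool → ℕ
    x false = proj₁ x₀
    x true  = proj₁ x₁
    x-part : ∀ b → part (x b) ≡ b
    x-part false = proj₁ (proj₂ x₀)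
    x-part true  = proj₁ (proj₂ x₁)
    x₁~x₀ : x true ~ x false
    x₁~x₀ = proj₂ (proj₂ x₁) _ (here refl) (λ eq → case trans (sym eq) (x-part false) of λ ())
    x-edge : ∀ b c → b ≢ c → x b ~ x c
    x-edge true  false _  = x₁~x₀
    x-edge false true  _  = ~-sym x₁~x₀
    x-edge true  true  ne = contradiction refl ne
    x-edge false false ne = contradiction refl ne
    parts : ∀ b c → part (fun f (x b)) ≡ part (fun f (x c)) → b ≡ c
    parts b c eq = trans (sym (x-part b)) (trans (part-image-reflects f eq) (x-part c))

  -- Allows the infinite case to use the kernel count, and the `K11` case to use the count of finite
  -- images.
  K11⇒finite : (f : End B) → ImageIsoK11 f → FiniteImage f
  K11⇒finite f (φ , _ , cover , _) = φ false ∷ φ true ∷ [] , λ y i → listed (cover y i)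
    where
    listed : ∀ {y} → ∃[ b ] φ b ≡ y → y ∈ φ false ∷ φ true ∷ []
    listed (false , refl) = here refl
    listed (true  , refl) = there (here refl)

theorem5p9 : LEM → (B : Str ℕ) → IsUniversalBipartite B →
    (f : End B) → Regular f →
    (InfiniteImage f →
    NumClassesInD _ℒ_ f Cantor _≈C_ × NumClassesInD _ℛ_ f Cantor _≈C_)
    × (FiniteImage f → ¬ ImageIsoK11 f →
    NumClassesInD _ℒ_ f ℕ _≡_ × NumClassesInD _ℛ_ f Cantor _≈C_)
    × (ImageIsoK11 f →
    NumClassesInD _ℒ_ f ℕ _≡_ × NumClassesInD _ℛ_ f ⊤ _≡_)
theorem5p9 lem B (part , bip , ext) f reg =
    (λ inf → ℒ-continuum inf , kernels (inf ∘ K11⇒finite f))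
  , (λ fin ¬K11 → ℒ-countable fin , kernels ¬K11)
  , (λ K11 → ℒ-countable (K11⇒finite f K11) , ℛ-single K11)
  where
  open Universal lem B part bip ext
  open Counting f reg
  kernels : ¬ ImageIsoK11 f → NumClassesInD _ℛ_ f Cantor _≈C_
  kernels ¬K11 = let _ , _ , same-part , f-separates = separated f ¬K11
                 in ℛ-continuum same-part f-separates
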